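{- Let $G$ be a connected graph of order $n$, minimum degree $\delta \geq 3$ and girth at least $6$. Then \[ \operatorname{avec}(G) \leq \frac{9}{2} \Big\lceil \frac{n}{\delta^*} \Big\rceil + 8, \] where $\delta^* = 2\delta^2-2\delta+2$.
   Context: All graphs are finite and simple. For a connected graph $G$, the eccentricity $e_G(v)$ of a vertex $v$ is $\max_{w\in V(G)} d_G(v,w)$, where $d_G$ is the usual shortest-path distance. The average eccentricity of $G$ is $\operatorname{avec}(G)=\frac{1}{n}\sum_{v\in V(G)} e_G(v)$, where $n=|V(G)|$. The girth of $G$ is the length of a shortest cycle in $G$ (infinite if $G$ is acyclic). -}

module Defs where

open import Data.Nat using (ℕ; zero; suc; _+_; _*_; _∸_; _/_; _≤_; _<_)
open import Data.Nat.DivMod using ()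
open import Data.Fin using (Fin)
open import Data.Bool using (Bool; true; false; T)
open import Data.Vec using (Vec; []; _∷_; lookup; head; last)
open import Data.List using (List; length; filter; allFin)
open import Data.Product using (Σ; ∃; _×_; _,_)
open import Relation.Binary.PropositionalEquality using (_≡_; _≢_)
open import Relation.Nullary using (¬_)
open import Relation.Nullary.Decidable using (does)
open import Data.Sum using (_⊎_)

record Graph (n : ℕ) : Set where
  field
    adj     : Fin n → Fin n → Bool
    symm    : ∀ u v → adj u v ≡ adj v u
    irrefl  : ∀ v → adj v v ≡ false
open Graph public

Adj : ∀ {n} → Graph n → Fin n → Fin n → Set
Adj G u v = T (adj G u v)

degree : ∀ {n} → Graph n → Fin n → ℕ
degree {n} G v = length (filter (λ w → T? (adj G v w)) (allFin n))
  where
  open import Data.Bool using () renaming (T? to T?)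

IsMinDegree : ∀ {n} → Graph n → ℕ → Set
IsMinDegree G δ = (∀ v → δ ≤ degree G v) × ∃ (λ v → degree G v ≡ δ)

data Walk {n : ℕ} (G : Graph n) : Fin n → Fin n → ℕ → Set where
  [] : ∀ {u} → Walk G u u 0
  _∷_ : ∀ {u w v k} → Adj G u w → Walk G w v k → Walk G u v (suc k)

Connected : ∀ {n} → Graph n → Set
Connected G = ∀ u v → ∃ (λ k → Walk G u v k)

IsDist : ∀ {n} → Graph n → Fin n → Fin n → ℕ → Set
IsDist G u v d = Walk G u v d × (∀ k → Walk G u v k → d ≤ k)

IsEcc : ∀ {n} → Graph n → Fin n → ℕ → Set
IsEcc G v e = (∀ w d → IsDist G v w d → d ≤ e) × ∃ (λ w → IsDist G v w e)

data Consecutive {n : ℕ} (G : Graph n) : ∀ {k} → Vec (Fin n) k → Set where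
  one  : ∀ {x} → Consecutive G (x ∷ [])
  more : ∀ {k x y} {xs : Vec (Fin n) k} →
         Adj G x y → Consecutive G (y ∷ xs) → Consecutive G (x ∷ y ∷ xs)

Distinct : ∀ {n k} → Vec (Fin n) k → Set
Distinct {k = k} xs = ∀ (i j : Fin k) → lookup xs i ≡ lookup xs j → i ≡ j

HasCycle : ∀ {n} → Graph n → ℕ → Set
HasCycle {n} G k =
  3 ≤ k × Σ (Vec (Fin n) k) (λ xs →
    Distinct xs × Consecutive G xs × CloseAdj xs)
  where
  CloseAdj : Vec (Fin n) k → Set
  CloseAdj [] = Data.Empty.⊥
    where import Data.Empty
  CloseAdj (x ∷ xs) = Adj G (last (x ∷ xs)) x

GirthAtLeast : ∀ {n} → Graph n → ℕ → Set
GirthAtLeast G g = ∀ k → HasCycle G k → g ≤ k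

-- ⌈ m / k ⌉ for k ≥ 1 (value at k = 0 is irrelevant, set to 0)
ceilDiv : ℕ → ℕ → ℕ
ceilDiv m zero = 0
ceilDiv m (suc k) = (m + k) / suc k

deltaStar : ℕ → ℕ
deltaStar δ = 2 * δ * δ ∸ 2 * δ + 2

sumFin : ∀ n → (Fin n → ℕ) → ℕ
sumFin zero f = 0
sumFin (suc n) f = f Fin.zero + sumFin n (λ i → f (Fin.suc i))
  where import Data.Fin as Fin

{-# OPTIONS --safe #-}

-- Girth at least 6 makes the second neighbourhoods of the two ends of an edge disjoint and as large
-- as possible, so the ball around an edge has at least δ* vertices. Choose edges greedily, at
-- distance 5 from an earlier edge and at least 5 from all others, until every vertex is within
-- distance 5 of a chosen edge. The balls are disjoint, and joining each edge to the one it was chosen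
-- from gives a tree H in which one step costs at most 6 in G: a vertex close to edge i has
-- eccentricity at most 6 e_H(i) + 11. By the four-point condition, the t-th vertex of a diametral
-- path of H, of length D, has e_H = max(t, D - t). So the δ* vertices of its ball fall short of
-- 6D + 11 by at least 6 min(t, D - t), and summing over t (about δ* D²/4) gives the bound.
module Submission where

open import Defs
open import Data.Bool using (Bool; true; false; T)
open import Data.Bool.Properties using (T?)
open import Data.Empty using (⊥)
open import Data.Fin using (Fin; zero; suc; toℕ; _≟_)
open import Data.Fin.Properties using (any?; all?; ¬∀⟶∃¬; injective⇒≤; toℕ<n; toℕ-injective)
open import Data.List using (List; []; _∷_; _++_; length; map; concat; filter; allFin; tabulate)
open import Data.List.Extrema.Nat using (argmax; f[xs]≤f[argmax])
open import Data.List.Membership.Propositional using (_∈_)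
open import Data.List.Membership.Propositional.Properties
  using (∈-∃++; ∈-++⁺ˡ; ∈-++⁺ʳ; ∈-++⁻; ∈-concat⁻′; ∈-map⁻; ∈-filter⁻; ∈-allFin)
open import Data.List.Properties
  using (length-++; map-++; map-tabulate; filter-all)
open import Data.List.Relation.Binary.Disjoint.Propositional using (Disjoint)
open import Data.List.Relation.Binary.Subset.Propositional using (_⊆_)
open import Data.List.Relation.Unary.All as All using (All; []; _∷_)
import Data.List.Relation.Unary.All.Properties as Allₚ
open import Data.List.Relation.Unary.AllPairs as AllPairs using (AllPairs; []; _∷_)
import Data.List.Relation.Unary.AllPairs.Properties as AllPairsₚ
open import Data.List.Relation.Unary.Any using (here; there)
open import Data.List.Relation.Unary.Unique.Propositional using (Unique)
import Data.List.Relation.Unary.Unique.Propositional.Properties as Uniqueₚ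
open import Data.Nat
  using (ℕ; zero; suc; _+_; _*_; _∸_; _⊔_; _⊓_; _/_; _%_; _≤_; _<_; z≤n; s≤s; >-nonZero)
open import Data.Nat.DivMod using (m≡m%n+[m/n]*n; m%n<n)
open import Data.Nat.ListAction using (sum)
open import Data.Nat.ListAction.Properties using (sum-++)
open import Data.Nat.Properties hiding (_≟_)
open import Data.Nat.Tactic.RingSolver using (solve-∀)
open import Data.Product using (Σ; ∃; ∃₂; _×_; _,_; proj₁; proj₂)
open import Data.Sum using (_⊎_; inj₁; inj₂; [_,_]′)
import Data.Sum as Sum
import Data.Vec as Vec
import Data.Vec.Relation.Unary.All as VecAll
import Data.Vec.Relation.Unary.AllPairs as VecAllPairs
import Data.Vec.Relation.Unary.Unique.Propositional.Properties as VecUniqueₚ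
open import Function using (_∘_; id)
open import Relation.Binary.PropositionalEquality
open import Relation.Nullary using (¬_; Dec; yes; no; contradiction; ¬?)
open import Relation.Nullary.Decidable using (map′; _⊎-dec_; _×-dec_)
open import Relation.Unary using (Decidable)

private variable
  n k : ℕ

-- Tree metrics

-- Built by attaching leaves, as the greedy choice of edges does: in `leaf T p` the new vertex is
-- `zero`, joined to the old vertex `p`, so distances come by recursion.
data Tree : ℕ → Set where
  single : Tree 1
  leaf   : Tree k → Fin k → Tree (suc k)

dist : Tree k → Fin k → Fin k → ℕ
dist single     _       _       = 0
dist (leaf T p) zero    zero    = 0
dist (leaf T p) zero    (suc j) = suc (dist T p j)
dist (leaf T p) (suc i) zero    = suc (dist T i p)
dist (leaf T p) (suc i) (suc j) = dist T i j

dist-sym : (T : Tree k) → ∀ i j → dist T i j ≡ dist T j i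
dist-sym single     _       _       = refl
dist-sym (leaf T p) zero    zero    = refl
dist-sym (leaf T p) zero    (suc j) = cong suc (dist-sym T p j)
dist-sym (leaf T p) (suc i) zero    = cong suc (dist-sym T i p)
dist-sym (leaf T p) (suc i) (suc j) = dist-sym T i j

-- The path out of a new leaf starts with the step to its parent; the rest lies in the smaller tree.
-- This supplies the vertex at each position of a diametral path.
dist-between : (T : Tree k) → ∀ i j a b → a + b ≡ dist T i j →
               ∃ λ q → dist T i q ≡ a × dist T q j ≡ b
dist-between single     i       j       zero    b eq = zero , refl , sym eq
dist-between (leaf T p) zero    zero    zero    b eq = zero , refl , sym eq
dist-between (leaf T p) zero    (suc j) zero    b eq = zero , refl , sym eq
dist-between (leaf T p) zero    (suc j) (suc a) b eq
  with q , iq , qj ← dist-between T p j a b (cong (_∸ 1) eq) = suc q , cong suc iq , qj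
dist-between (leaf T p) (suc i) zero    a zero eq =
  zero , trans (sym eq) (+-identityʳ a) , refl
dist-between (leaf T p) (suc i) zero    a (suc b) eq
  with q , iq , qj ← dist-between T i p a b (cong (_∸ 1) (trans (sym (+-suc a b)) eq)) =
  suc q , iq , cong suc qj
dist-between (leaf T p) (suc i) (suc j) a b eq
  with q , iq , qj ← dist-between T i j a b eq = suc q , iq , qj

-- If exactly one argument is the new leaf, moving it to its parent lowers all three sums by one.
-- Coinciding leaves leave trivial comparisons or the triangle inequality of the smaller tree,
-- itself the case `x = y` of this condition; hence the mutual recursion.
four-point : (T : Tree k) → ∀ i j x y →
  dist T i j + dist T x y ≤ dist T i x + dist T j y ⊎
  dist T i j + dist T x y ≤ dist T i y + dist T j x

dist-triangle : (T : Tree k) → ∀ i x j → dist T i j ≤ dist T i x + dist T x j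
dist-triangle T i x j = begin
  dist T i j               ≤⟨ m≤m+n _ _ ⟩
  dist T i j + dist T x x  ≤⟨ [ id , id ]′ (four-point T i j x x) ⟩
  dist T i x + dist T j x  ≡⟨ cong (dist T i x +_) (dist-sym T j x) ⟩
  dist T i x + dist T x j  ∎
  where open ≤-Reasoning

four-point single _ _ _ _ = inj₁ z≤n
four-point (leaf T p) zero zero zero zero = inj₁ z≤n
four-point (leaf T p) zero zero zero (suc y) = inj₁ ≤-refl
four-point (leaf T p) zero zero (suc x) zero =
  inj₁ (≤-reflexive (trans (cong suc (dist-sym T x p)) (sym (+-identityʳ _))))
four-point (leaf T p) zero zero (suc x) (suc y) = inj₁ (begin
  dist T x y                           ≤⟨ dist-triangle T x p y ⟩
  dist T x p + dist T p y              ≡⟨ cong (_+ dist T p y) (dist-sym T x p) ⟩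
  dist T p x + dist T p y              ≤⟨ +-mono-≤ (n≤1+n _) (n≤1+n _) ⟩
  suc (dist T p x) + suc (dist T p y)  ∎)
  where open ≤-Reasoning
four-point (leaf T p) zero (suc j) zero zero =
  inj₁ (≤-reflexive (trans (+-identityʳ _) (cong suc (dist-sym T p j))))
four-point (leaf T p) zero (suc j) zero (suc y) =
  inj₂ (≤-reflexive (trans (+-comm (suc (dist T p j)) _)
    (cong (λ z → suc (dist T p y) + suc z) (dist-sym T p j))))
four-point (leaf T p) zero (suc j) (suc x) zero =
  inj₁ (≤-reflexive (trans (+-comm (suc (dist T p j)) _)
    (cong₂ (λ z w → suc z + suc w) (dist-sym T x p) (dist-sym T p j))))
four-point (leaf T p) zero (suc j) (suc x) (suc y) = Sum.map s≤s s≤s (four-point T p j x y)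
four-point (leaf T p) (suc i) zero zero zero = inj₁ ≤-refl
four-point (leaf T p) (suc i) zero zero (suc y) = inj₁ ≤-refl
four-point (leaf T p) (suc i) zero (suc x) zero =
  inj₂ (≤-reflexive (cong (λ z → suc (dist T i p) + suc z) (dist-sym T x p)))
four-point (leaf T p) (suc i) zero (suc x) (suc y)
  rewrite +-suc (dist T i x) (dist T p y) | +-suc (dist T i y) (dist T p x) =
  Sum.map s≤s s≤s (four-point T i p x y)
four-point (leaf T p) (suc i) (suc j) zero zero = inj₁ (begin
  dist T i j + 0                       ≡⟨ +-identityʳ _ ⟩
  dist T i j                           ≤⟨ dist-triangle T i p j ⟩
  dist T i p + dist T p j              ≡⟨ cong (dist T i p +_) (dist-sym T p j) ⟩
  dist T i p + dist T j p              ≤⟨ +-mono-≤ (n≤1+n _) (n≤1+n _) ⟩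
  suc (dist T i p) + suc (dist T j p)  ∎)
  where open ≤-Reasoning
four-point (leaf T p) (suc i) (suc j) zero (suc y)
  rewrite +-suc (dist T i j) (dist T p y) | +-suc (dist T i y) (dist T j p) =
  Sum.map s≤s s≤s (four-point T i j p y)
four-point (leaf T p) (suc i) (suc j) (suc x) zero
  rewrite +-suc (dist T i j) (dist T x p) | +-suc (dist T i x) (dist T j p) =
  Sum.map s≤s s≤s (four-point T i j x p)
four-point (leaf T p) (suc i) (suc j) (suc x) (suc y) = four-point T i j x y

root : Tree k → Fin k
root single     = zero
root (leaf _ _) = zero

maximum : Fin k → (f : Fin k → ℕ) → ∃ λ i → ∀ j → f j ≤ f i
maximum i f = argmax f i (allFin _) , λ j → All.lookup (f[xs]≤f[argmax] i (allFin _)) (∈-allFin j)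

diameter : (T : Tree k) → ∃₂ λ x y → ∀ i j → dist T i j ≤ dist T x y
diameter T =
  let farthest i = maximum (root T) (dist T i)
      x , max    = maximum (root T) (λ i → dist T i (proj₁ (farthest i)))
  in x , proj₁ (farthest x) , λ i j → ≤-trans (proj₂ (farthest i) j) (max i)

-- Along a diametral path of a tree, eccentricities are attained at the ends of the path.
dist-from-diametral : (T : Tree k) → ∀ x y → (∀ i j → dist T i j ≤ dist T x y) →
  ∀ q j → dist T q j ≤ dist T x q ⊔ dist T q y
dist-from-diametral T x y max q j with four-point T q j x y
-- `dist T j y` is at most the diameter `dist T x y`, which then cancels.
... | inj₁ le = m≤n⇒m≤n⊔o _ (+-cancelʳ-≤ (dist T x y) _ _
  (≤-trans le (+-mono-≤ (≤-reflexive (dist-sym T q x)) (max j y))))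
... | inj₂ le = m≤n⇒m≤o⊔n _ (+-cancelʳ-≤ (dist T x y) _ _
  (≤-trans le (+-monoʳ-≤ _ (max j x))))

-- Finite sums

sumFin-tabulate : ∀ n (f : Fin n → ℕ) → sumFin n f ≡ sum (tabulate f)
sumFin-tabulate zero    f = refl
sumFin-tabulate (suc n) f = cong (f zero +_) (sumFin-tabulate n (f ∘ suc))

-- Each entry of `xs` is matched with one occurrence in `ys` and deleted there; uniqueness keeps the
-- tail of `xs` inside what remains.
sum-⊆ : {A : Set} (g : A → ℕ) {xs ys : List A} → Unique xs → xs ⊆ ys →
        sum (map g xs) ≤ sum (map g ys)
sum-⊆ g []         sub = z≤n
sum-⊆ g {x ∷ xs} (x∉ ∷ uniq) sub with as , bs , refl ← ∈-∃++ (sub (here refl)) = begin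
  g x + sum (map g xs)                        ≤⟨ +-monoʳ-≤ (g x) (sum-⊆ g uniq rest) ⟩
  g x + sum (map g (as ++ bs))                ≡⟨ cong (g x +_) (split as bs) ⟩
  g x + (sum (map g as) + sum (map g bs))     ≡⟨ shuffle (g x) (sum (map g as)) _ ⟩
  sum (map g as) + sum (map g (x ∷ bs))       ≡⟨ split as (x ∷ bs) ⟨
  sum (map g (as ++ x ∷ bs))                  ∎
  where
  open ≤-Reasoning
  split : ∀ as bs → sum (map g (as ++ bs)) ≡ sum (map g as) + sum (map g bs)
  split as bs = trans (cong sum (map-++ g as bs)) (sum-++ (map g as) (map g bs))
  shuffle : ∀ a b c → a + (b + c) ≡ b + (a + c)
  shuffle = solve-∀
  rest : xs ⊆ as ++ bs
  rest z∈ with ∈-++⁻ as (sub (there z∈))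
  ... | inj₁ z∈as         = ∈-++⁺ˡ z∈as
  ... | inj₂ (here z≡x)   = contradiction (sym z≡x) (All.lookup x∉ z∈)
  ... | inj₂ (there z∈bs) = ∈-++⁺ʳ as z∈bs

sum-unique≤sumFin : (g : Fin n → ℕ) {xs : List (Fin n)} → Unique xs → sum (map g xs) ≤ sumFin n g
sum-unique≤sumFin {n} g uniq = ≤-trans (sum-⊆ g uniq (λ {z} _ → ∈-allFin z))
  (≤-reflexive (sym (trans (sumFin-tabulate n g) (cong sum (sym (map-tabulate id g))))))

length*c≤sum : {A : Set} (h : A → ℕ) (c : ℕ) (xs : List A) → (∀ {x} → x ∈ xs → c ≤ h x) →
               length xs * c ≤ sum (map h xs)
length*c≤sum h c []       _  = z≤n
length*c≤sum h c (x ∷ xs) lb = +-mono-≤ (lb (here refl)) (length*c≤sum h c xs (lb ∘ there))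

-- The weighted packing count: the blocks `B t` will be disjoint balls, and `c t` a lower bound for
-- the weight of each vertex in them.
sum-concat-tabulate : {A : Set} (h : A → ℕ) (s : ℕ) → ∀ m (c : Fin m → ℕ) (B : Fin m → List A) →
  (∀ t → s ≤ length (B t)) → (∀ t {x} → x ∈ B t → c t ≤ h x) →
  s * sumFin m c ≤ sum (map h (concat (tabulate B)))
sum-concat-tabulate h s zero    c B len lb = ≤-reflexive (*-zeroʳ s)
sum-concat-tabulate h s (suc m) c B len lb = begin
  s * (c zero + sumFin m (c ∘ suc))        ≡⟨ *-distribˡ-+ s (c zero) _ ⟩
  s * c zero + s * sumFin m (c ∘ suc)
    ≤⟨ +-mono-≤ (≤-trans (*-monoˡ-≤ (c zero) (len zero)) (length*c≤sum h (c zero) (B zero) (lb zero)))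
                (sum-concat-tabulate h s m (c ∘ suc) (B ∘ suc) (len ∘ suc) (lb ∘ suc)) ⟩
  sum (map h (B zero)) + sum (map h rest)  ≡⟨ sum-++ (map h (B zero)) _ ⟨
  sum (map h (B zero) ++ map h rest)       ≡⟨ cong sum (map-++ h (B zero) rest) ⟨
  sum (map h (B zero ++ rest))             ∎
  where
  open ≤-Reasoning
  rest = concat (tabulate (B ∘ suc))

sumFin-complement : ∀ n c (f : Fin n → ℕ) → (∀ i → f i ≤ c) →
  sumFin n f + sumFin n (λ i → c ∸ f i) ≡ n * c
sumFin-complement zero    c f f≤c = refl
sumFin-complement (suc n) c f f≤c = begin
  (f zero + sumFin n (f ∘ suc)) + ((c ∸ f zero) + sumFin n (λ i → c ∸ f (suc i)))
    ≡⟨ interchange (f zero) _ _ _ ⟩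
  (f zero + (c ∸ f zero)) + (sumFin n (f ∘ suc) + sumFin n (λ i → c ∸ f (suc i)))
    ≡⟨ cong₂ _+_ (m+[n∸m]≡n (f≤c zero)) (sumFin-complement n c (f ∘ suc) (f≤c ∘ suc)) ⟩
  c + n * c ∎
  where
  open ≡-Reasoning
  interchange : ∀ a b c d → (a + b) + (c + d) ≡ (a + c) + (b + d)
  interchange = solve-∀

sumFin-const : ∀ n c → sumFin n (λ _ → c) ≡ n * c
sumFin-const zero    c = refl
sumFin-const (suc n) c = cong (c +_) (sumFin-const n c)

sumFin-cong : ∀ n {f g : Fin n → ℕ} → (∀ i → f i ≡ g i) → sumFin n f ≡ sumFin n g
sumFin-cong zero    eq = refl
sumFin-cong (suc n) eq = cong₂ _+_ (eq zero) (sumFin-cong n (eq ∘ suc))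

sumFin-*ˡ : ∀ n c (f : Fin n → ℕ) → sumFin n (λ i → c * f i) ≡ c * sumFin n f
sumFin-*ˡ zero    c f = sym (*-zeroʳ c)
sumFin-*ˡ (suc n) c f =
  trans (cong (c * f zero +_) (sumFin-*ˡ n c (f ∘ suc))) (sym (*-distribˡ-+ c (f zero) _))

sumFin-snoc : ∀ n (f : ℕ → ℕ) → sumFin (suc n) (f ∘ toℕ) ≡ sumFin n (f ∘ toℕ) + f n
sumFin-snoc zero    f = +-comm (f 0) 0
sumFin-snoc (suc n) f = trans (cong (f 0 +_) (sumFin-snoc n (f ∘ suc))) (sym (+-assoc (f 0) _ _))

-- In closed form this is the floor of D²/4.
endDistanceSum : ℕ → ℕ
endDistanceSum D = sumFin (suc D) (λ t → toℕ t ⊓ (D ∸ toℕ t))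

-- The two end terms vanish, and each of the D + 1 inner terms is one more than its counterpart for
-- `D`.
endDistanceSum-2+ : ∀ D → endDistanceSum (2 + D) ≡ suc D + endDistanceSum D
endDistanceSum-2+ D = begin
  sumFin (2 + D) (λ t → suc (toℕ t) ⊓ (1 + D ∸ toℕ t))
    ≡⟨ sumFin-snoc (suc D) (λ t → suc t ⊓ (1 + D ∸ t)) ⟩
  sumFin (suc D) (λ t → suc (toℕ t) ⊓ (1 + D ∸ toℕ t)) + suc (suc D) ⊓ (1 + D ∸ suc D)
    ≡⟨ cong₂ _+_ (sumFin-cong (suc D) λ t → cong (suc (toℕ t) ⊓_) (+-∸-assoc 1 (≤-pred (toℕ<n t))))
                 (cong (suc (suc D) ⊓_) (n∸n≡0 D)) ⟩
  sumFin (suc D) (λ t → suc (toℕ t ⊓ (D ∸ toℕ t))) + 0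
    ≡⟨ +-identityʳ _ ⟩
  sumFin (suc D) (λ t → suc (toℕ t ⊓ (D ∸ toℕ t)))
    ≡⟨ sumFin-suc (suc D) (λ t → toℕ t ⊓ (D ∸ toℕ t)) ⟩
  suc D + endDistanceSum D ∎
  where
  open ≡-Reasoning
  shuffle : ∀ a b c → suc a + (b + c) ≡ suc (b + (a + c))
  shuffle = solve-∀
  sumFin-suc : ∀ n (f : Fin n → ℕ) → sumFin n (suc ∘ f) ≡ n + sumFin n f
  sumFin-suc zero    f = refl
  sumFin-suc (suc n) f =
    trans (cong (suc (f zero) +_) (sumFin-suc n (f ∘ suc))) (shuffle (f zero) n _)

-- Induction in steps of two, since (D + 2)² - D² = 4(D + 1); the summand 1 accounts for odd `D`.
D²≤1+4*endDistanceSum : ∀ D → D * D ≤ 1 + 4 * endDistanceSum D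
D²≤1+4*endDistanceSum 0 = z≤n
D²≤1+4*endDistanceSum 1 = ≤-refl
D²≤1+4*endDistanceSum (suc (suc D)) = begin
  (2 + D) * (2 + D)                  ≡⟨ expand D ⟩
  D * D + 4 * suc D                  ≤⟨ +-monoˡ-≤ _ (D²≤1+4*endDistanceSum D) ⟩
  1 + 4 * e + 4 * suc D              ≡⟨ collect (suc D) e ⟩
  1 + 4 * (suc D + e)                ≡⟨ cong (λ z → 1 + 4 * z) (endDistanceSum-2+ D) ⟨
  1 + 4 * endDistanceSum (2 + D)     ∎
  where
  open ≤-Reasoning
  e = endDistanceSum D
  expand : ∀ D → (2 + D) * (2 + D) ≡ D * D + 4 * suc D
  expand = solve-∀
  collect : ∀ a e → 1 + 4 * e + 4 * a ≡ 1 + 4 * (a + e)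
  collect = solve-∀

-- Balls around an edge

removeOne : (x : Fin n) {xs : List (Fin n)} → Unique xs →
            length xs ≤ suc (length (filter (λ w → ¬? (w ≟ x)) xs))
removeOne x [] = z≤n
removeOne x {y ∷ xs} (y∉ ∷ uniq) with y ≟ x
... | yes refl = ≤-reflexive (cong suc (sym (cong length
                   (filter-all (λ w → ¬? (w ≟ x)) (All.map (_∘ sym) y∉)))))
... | no  _    = s≤s (removeOne x uniq)

length-concat-≥ : {A B : Set} (f : A → List B) (c : ℕ) (xs : List A) → (∀ x → c ≤ length (f x)) →
                  length xs * c ≤ length (concat (map f xs))
length-concat-≥ f c []       lb = z≤n
length-concat-≥ f c (x ∷ xs) lb = ≤-trans (+-mono-≤ (lb x) (length-concat-≥ f c xs lb))
  (≤-reflexive (sym (length-++ (f x))))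

module _ {n : ℕ} (G : Graph n) where

  neighbours : Fin n → List (Fin n)
  neighbours v = filter (λ w → T? (adj G v w)) (allFin n)

  neighbours⇒Adj : ∀ {v w} → w ∈ neighbours v → Adj G v w
  neighbours⇒Adj {v} w∈ = proj₂ (∈-filter⁻ (λ w → T? (adj G v w)) {xs = allFin n} w∈)

  neighbours-unique : ∀ v → Unique (neighbours v)
  neighbours-unique v = Uniqueₚ.filter⁺ (λ w → T? (adj G v w)) (Uniqueₚ.allFin⁺ n)

  Adj-sym : ∀ {u v} → Adj G u v → Adj G v u
  Adj-sym {u} {v} = subst T (symm G u v)

  Adj⇒≢ : ∀ {u v} → Adj G u v → u ≢ v
  Adj⇒≢ {u} a refl = subst T (irrefl G u) a

  furtherNeighbours : Fin n → Fin n → List (Fin n)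
  furtherNeighbours u x = filter (λ w → ¬? (w ≟ u)) (neighbours x)

  -- The neighbours of `u` are left out, since for an edge they occur in the list of the other end.
  -- Under the girth condition the two lists of an edge give at least 2(1 + δ(δ - 1)) = δ* distinct
  -- vertices.
  secondNeighbourhood : Fin n → List (Fin n)
  secondNeighbourhood u = u ∷ concat (map (furtherNeighbours u) (neighbours u))

  furtherNeighbours⁻ : ∀ {u x w} → w ∈ furtherNeighbours u x → Adj G x w × w ≢ u
  furtherNeighbours⁻ {u} {x} w∈ with w∈N , w≢u ← ∈-filter⁻ (λ w → ¬? (w ≟ u)) {xs = neighbours x} w∈ =
    neighbours⇒Adj w∈N , w≢u

  concat-furtherNeighbours⁻ : ∀ {u w} → w ∈ concat (map (furtherNeighbours u) (neighbours u)) →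
                              ∃ λ x → Adj G u x × Adj G x w × w ≢ u
  concat-furtherNeighbours⁻ {u} w∈
    with _ , w∈ys , ys∈ ← ∈-concat⁻′ (map (furtherNeighbours u) (neighbours u)) w∈
    with x , x∈ , refl ← ∈-map⁻ (furtherNeighbours u) ys∈ =
    x , neighbours⇒Adj x∈ , furtherNeighbours⁻ w∈ys

  -- The edge lets `u` itself be reached by a two-step walk there and back, so all members are
  -- described alike.
  secondNeighbourhood⁻ : ∀ {u v w} → Adj G u v → w ∈ secondNeighbourhood u →
                         ∃ λ x → Adj G u x × Adj G x w
  secondNeighbourhood⁻ a (here refl) = _ , a , Adj-sym a
  secondNeighbourhood⁻ a (there w∈) with x , ux , xw , _ ← concat-furtherNeighbours⁻ w∈ = x , ux , xw

  length-secondNeighbourhood : ∀ {d} → (∀ v → suc d ≤ degree G v) → ∀ u →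
                               suc (suc d * d) ≤ length (secondNeighbourhood u)
  length-secondNeighbourhood {d} deg u = s≤s (≤-trans (*-monoˡ-≤ d (deg u))
    (length-concat-≥ (furtherNeighbours u) d (neighbours u)
      (λ x → ≤-pred (≤-trans (deg x) (removeOne u (neighbours-unique x))))))

  module _ (girth : GirthAtLeast G 6) where

    no-triangle : ∀ {a b c} → Adj G a b → Adj G b c → Adj G c a → ⊥
    no-triangle {a} {b} {c} ab bc ca = contradiction (girth 3 (≤-refl , xs ,
      VecUniqueₚ.lookup-injective unique , more ab (more bc one) , ca)) λ { (s≤s (s≤s (s≤s ()))) }
      where
      xs = a Vec.∷ b Vec.∷ c Vec.∷ Vec.[]
      unique : VecAllPairs.AllPairs _≢_ xs
      unique = (Adj⇒≢ ab VecAll.∷ Adj⇒≢ ca ∘ sym VecAll.∷ VecAll.[])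
        VecAllPairs.∷ (Adj⇒≢ bc VecAll.∷ VecAll.[])
        VecAllPairs.∷ VecAll.[]
        VecAllPairs.∷ VecAllPairs.[]

    -- Closed walks of length four may be degenerate, so opposite vertices have to be assumed
    -- distinct.
    no-quadrilateral : ∀ {a b c d} → a ≢ c → b ≢ d →
      Adj G a b → Adj G b c → Adj G c d → Adj G d a → ⊥
    no-quadrilateral {a} {b} {c} {d} a≢c b≢d ab bc cd da = contradiction (girth 4 (n≤1+n 3 , xs ,
      VecUniqueₚ.lookup-injective unique , more ab (more bc (more cd one)) , da))
      λ { (s≤s (s≤s (s≤s (s≤s ())))) }
      where
      xs = a Vec.∷ b Vec.∷ c Vec.∷ d Vec.∷ Vec.[]
      unique : VecAllPairs.AllPairs _≢_ xs
      unique = (Adj⇒≢ ab VecAll.∷ a≢c VecAll.∷ Adj⇒≢ da ∘ sym VecAll.∷ VecAll.[])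
        VecAllPairs.∷ (Adj⇒≢ bc VecAll.∷ b≢d VecAll.∷ VecAll.[])
        VecAllPairs.∷ (Adj⇒≢ cd VecAll.∷ VecAll.[])
        VecAllPairs.∷ VecAll.[]
        VecAllPairs.∷ VecAllPairs.[]

    -- A repeated vertex in a closed 5-walk would leave a triangle.
    no-pentagon : ∀ {a b c d e} →
      Adj G a b → Adj G b c → Adj G c d → Adj G d e → Adj G e a → ⊥
    no-pentagon {a} {b} {c} {d} {e} ab bc cd de ea = contradiction (girth 5 (m≤m+n 3 2 , xs ,
      VecUniqueₚ.lookup-injective unique , more ab (more bc (more cd (more de one))) , ea))
      λ { (s≤s (s≤s (s≤s (s≤s (s≤s ()))))) }
      where
      xs = a Vec.∷ b Vec.∷ c Vec.∷ d Vec.∷ e Vec.∷ Vec.[]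
      unique : VecAllPairs.AllPairs _≢_ xs
      unique = (Adj⇒≢ ab VecAll.∷ (λ { refl → no-triangle cd de ea })
                         VecAll.∷ (λ { refl → no-triangle ab bc cd })
                         VecAll.∷ Adj⇒≢ ea ∘ sym VecAll.∷ VecAll.[])
        VecAllPairs.∷ (Adj⇒≢ bc VecAll.∷ (λ { refl → no-triangle de ea ab })
                                VecAll.∷ (λ { refl → no-triangle bc cd de }) VecAll.∷ VecAll.[])
        VecAllPairs.∷ (Adj⇒≢ cd VecAll.∷ (λ { refl → no-triangle ea ab bc }) VecAll.∷ VecAll.[])
        VecAllPairs.∷ (Adj⇒≢ de VecAll.∷ VecAll.[])
        VecAllPairs.∷ VecAll.[]
        VecAllPairs.∷ VecAllPairs.[]

    -- `u` does not recur because it was filtered out, and a vertex reached through two different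
    -- neighbours of `u` would close a quadrilateral.
    secondNeighbourhood-unique : ∀ u → Unique (secondNeighbourhood u)
    secondNeighbourhood-unique u =
      All.tabulate (λ w∈ u≡w → proj₂ (proj₂ (proj₂ (concat-furtherNeighbours⁻ w∈))) (sym u≡w))
      ∷ Uniqueₚ.concat⁺
          (Allₚ.map⁺ (All.tabulate λ {x} _ →
            Uniqueₚ.filter⁺ (λ w → ¬? (w ≟ u)) (neighbours-unique x)))
          (AllPairsₚ.map⁺ (disjoint (neighbours-unique u) neighbours⇒Adj))
      where
      disjoint : ∀ {xs} → Unique xs → (∀ {x} → x ∈ xs → Adj G u x) →
                 AllPairs (λ x y → Disjoint (furtherNeighbours u x) (furtherNeighbours u y)) xs
      disjoint []                      adjacent = []
      disjoint (x∉ ∷ uniq) adjacent =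
        All.tabulate (λ y∈ {w} (w∈x , w∈y) →
          let xw , w≢u = furtherNeighbours⁻ w∈x
              yw , _   = furtherNeighbours⁻ w∈y
          in no-quadrilateral (w≢u ∘ sym) (All.lookup x∉ y∈)
               (adjacent (here refl)) xw (Adj-sym yw) (Adj-sym (adjacent (there y∈))))
        ∷ disjoint uniq (adjacent ∘ there)

    -- A common vertex would close a walk of length 2 + 2 + 1 through the edge.
    secondNeighbourhood-disjoint : ∀ {u v} → Adj G u v →
      Disjoint (secondNeighbourhood u) (secondNeighbourhood v)
    secondNeighbourhood-disjoint uv (w∈u , w∈v)
      with x , ux , xw ← secondNeighbourhood⁻ uv w∈u
      with y , vy , yw ← secondNeighbourhood⁻ (Adj-sym uv) w∈v =
      no-pentagon ux xw (Adj-sym yw) (Adj-sym vy) (Adj-sym uv)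

  edgeBall : Fin n → Fin n → List (Fin n)
  edgeBall u v = secondNeighbourhood u ++ secondNeighbourhood v

  edgeBall-unique : GirthAtLeast G 6 → ∀ {u v} → Adj G u v → Unique (edgeBall u v)
  edgeBall-unique girth {u} {v} uv = Uniqueₚ.++⁺ (secondNeighbourhood-unique girth u)
    (secondNeighbourhood-unique girth v) (secondNeighbourhood-disjoint girth uv)

  length-edgeBall : ∀ {d} → (∀ v → suc d ≤ degree G v) → ∀ u v →
                    deltaStar (suc d) ≤ length (edgeBall u v)
  length-edgeBall {d} deg u v = begin
    -- With 2δ² split as 2δ(δ - 1) + 2δ, the truncated subtraction in `deltaStar` cancels exactly.
    2 * suc d * suc d ∸ 2 * suc d + 2         ≡⟨ cong (λ z → z ∸ 2 * suc d + 2) (expand d) ⟩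
    2 * (suc d * d) + 2 * suc d ∸ 2 * suc d + 2 ≡⟨ cong (_+ 2) (m+n∸n≡m (2 * (suc d * d)) (2 * suc d)) ⟩
    2 * (suc d * d) + 2                       ≡⟨ double (suc d * d) ⟩
    suc (suc d * d) + suc (suc d * d)
      ≤⟨ +-mono-≤ (length-secondNeighbourhood deg u) (length-secondNeighbourhood deg v) ⟩
    length (secondNeighbourhood u) + length (secondNeighbourhood v) ≡⟨ length-++ (secondNeighbourhood u) ⟨
    length (edgeBall u v)                     ∎
    where
    open ≤-Reasoning
    expand : ∀ d → 2 * suc d * suc d ≡ 2 * (suc d * d) + 2 * suc d
    expand = solve-∀
    double : ∀ a → 2 * a + 2 ≡ suc a + suc a
    double = solve-∀

  -- Walks of bounded length

  -- The index is a budget, and `stop` accepts whatever is left of it; this makes the relation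
  -- monotone in `r` and decidable by recursion.
  data Near : ℕ → Fin n → Fin n → Set where
    stop : ∀ {r u} → Near r u u
    step : ∀ {r u w v} → Adj G u w → Near r w v → Near (suc r) u v

  near-≤ : ∀ {r s u v} → r ≤ s → Near r u v → Near s u v
  near-≤ _         stop       = stop
  near-≤ (s≤s r≤s) (step a p) = step a (near-≤ r≤s p)

  near-trans : ∀ {r s u v w} → Near r u v → Near s v w → Near (r + s) u w
  near-trans {r} stop       q = near-≤ (m≤n+m _ r) q
  near-trans     (step a p) q = step a (near-trans p q)

  near-snoc : ∀ {r u v w} → Near r u v → Adj G v w → Near (suc r) u w
  near-snoc stop       b = step b stop
  near-snoc (step a p) b = step a (near-snoc p b)

  near-sym : ∀ {r u v} → Near r u v → Near r v u
  near-sym stop       = stop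
  near-sym (step a p) = near-snoc (near-sym p) (Adj-sym a)

  near? : ∀ r u v → Dec (Near r u v)
  near? zero u v = map′ (λ { refl → stop }) (λ { stop → refl }) (u ≟ v)
  near? (suc r) u v = map′
    (λ { (inj₁ refl) → stop ; (inj₂ (_ , a , p)) → step a p })
    (λ { stop → inj₁ refl ; (step a p) → inj₂ (_ , a , p) })
    (u ≟ v ⊎-dec any? (λ w → T? (adj G u w) ×-dec near? r w v))

  near⇒walk : ∀ {r u v} → Near r u v → ∃ λ m → m ≤ r × Walk G u v m
  near⇒walk stop       = 0 , z≤n , []
  near⇒walk (step a p) with m , m≤r , walk ← near⇒walk p = suc m , s≤s m≤r , a ∷ walk

  dist≤near : ∀ {r u v d} → IsDist G u v d → Near r u v → d ≤ r
  dist≤near (_ , minimal) p with m , m≤r , walk ← near⇒walk p = ≤-trans (minimal m walk) m≤r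

  -- Applied to the set of covered vertices, this finds the next edge of the greedy choice.
  crossing : {P : Fin n → Set} → Decidable P → ∀ {u v l} → Walk G u v l → P u → ¬ P v →
             ∃₂ λ x y → Adj G x y × P x × ¬ P y
  crossing P? []                  pu ¬pv = contradiction pu ¬pv
  crossing P? {u} (_∷_ {w = w} a walk) pu ¬pv with P? w
  ... | yes pw = crossing P? walk pw ¬pv
  ... | no ¬pw = u , w , a , pu , ¬pw

  edgeBall⇒near : ∀ {u v w} → Adj G u v → w ∈ edgeBall u v → Near 2 u w ⊎ Near 2 v w
  edgeBall⇒near {u} uv w∈ with ∈-++⁻ (secondNeighbourhood u) w∈
  ... | inj₁ w∈u with x , ux , xw ← secondNeighbourhood⁻ uv w∈u = inj₁ (step ux (step xw stop))
  ... | inj₂ w∈v with x , vx , xw ← secondNeighbourhood⁻ (Adj-sym uv) w∈v =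
    inj₂ (step vx (step xw stop))

  -- Trees of separated edges

  -- The chosen edges with the tree H on them. Separation by more than 4 keeps balls of radius 2
  -- disjoint; in `linked` a tree step costs 6, and the extra 1 allows for passing between the two
  -- ends of an edge.
  record Skeleton (k : ℕ) : Set where
    field
      tree      : Tree k
      end       : Fin k → Bool → Fin n
      edge      : ∀ i → Adj G (end i false) (end i true)
      separated : ∀ {i j} b b′ → i ≢ j → ¬ Near 4 (end i b) (end j b′)
      linked    : ∀ i j b b′ → Near (suc (6 * dist tree i j)) (end i b) (end j b′)

  module _ {k : ℕ} (S : Skeleton k) where
    open Skeleton S

    NearEdge : Fin k → Fin n → Set
    NearEdge i v = ∃ λ b → Near 5 (end i b) v

    Covered : Fin n → Set
    Covered v = ∃ λ i → NearEdge i v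

    covered? : Decidable Covered
    covered? v = any? λ i → map′
      (λ { (inj₁ p) → false , p ; (inj₂ p) → true , p })
      (λ { (false , p) → inj₁ p ; (true , p) → inj₂ p })
      (near? 5 (end i false) v ⊎-dec near? 5 (end i true) v)

    -- Separation forces distinct edges to have distinct ends, which bounds the number of greedy
    -- steps.
    skeleton-size : k ≤ n
    skeleton-size = injective⇒≤ {f = λ i → end i false} injective
      where
      injective : ∀ {i j} → end i false ≡ end j false → i ≡ j
      injective {i} {j} eq with i ≟ j
      ... | yes i≡j = i≡j
      ... | no  i≢j = contradiction (subst (Near 4 (end i false)) eq stop) (separated false false i≢j)

    ball : Fin k → List (Fin n)
    ball i = edgeBall (end i false) (end i true)

    ball⇒near : ∀ {i w} → w ∈ ball i → ∃ λ b → Near 2 (end i b) w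
    ball⇒near {i} w∈ with edgeBall⇒near (edge i) w∈
    ... | inj₁ p = false , p
    ... | inj₂ p = true , p

    -- A common vertex would put the two edges at distance at most 2 + 2.
    ball-disjoint : ∀ {i j} → i ≢ j → Disjoint (ball i) (ball j)
    ball-disjoint i≢j (w∈i , w∈j) with b , p ← ball⇒near w∈i | b′ , q ← ball⇒near w∈j =
      separated b b′ i≢j (near-trans p (near-sym q))

    -- At most 5 to the first edge, 6 per tree step plus 1, and 5 from the last edge.
    near-edges : ∀ {i j v w} → NearEdge i v → NearEdge j w → Near (6 * dist tree i j + 11) v w
    near-edges {i} {j} (b , p) (b′ , q) = near-≤ (≤-reflexive (collect (6 * dist tree i j)))
      (near-trans (near-sym p) (near-trans (linked i j b b′) q))
      where
      collect : ∀ a → 5 + (suc a + 5) ≡ a + 11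
      collect = solve-∀

    -- u is within distance 5 of the old edges but its neighbour w is not, so both are at distance
    -- at least 5 from all of them.
    extend : ∀ {u w} → Adj G u w → Covered u → ¬ Covered w → Skeleton (suc k)
    extend {u} {w} uw (p , b₀ , near-u) uncovered = record
      { tree = leaf tree p ; end = end′ ; edge = edge′ ; separated = separated′ ; linked = linked′ }
      where
      end′ : Fin (suc k) → Bool → Fin n
      end′ zero    false = u
      end′ zero    true  = w
      end′ (suc i) b     = end i b

      edge′ : ∀ i → Adj G (end′ i false) (end′ i true)
      edge′ zero    = uw
      edge′ (suc i) = edge i

      new-far : ∀ i b b′ → ¬ Near 4 (end i b) (end′ zero b′)
      -- Within 4 of `u` means within 5 of its neighbour `w`, which would cover `w`.
      new-far i b false near = uncovered (i , b , near-snoc near uw)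
      new-far i b true  near = uncovered (i , b , near-≤ (n≤1+n 4) near)

      separated′ : ∀ {i j} b b′ → i ≢ j → ¬ Near 4 (end′ i b) (end′ j b′)
      separated′ {zero}  {zero}  b b′ i≢j near = i≢j refl
      separated′ {zero}  {suc j} b b′ i≢j near = new-far j b′ b (near-sym near)
      separated′ {suc i} {zero}  b b′ i≢j near = new-far i b b′ near
      separated′ {suc i} {suc j} b b′ i≢j near = separated b b′ (i≢j ∘ cong suc) near

      -- `b₀` marks the end of the parent edge within 5 of `u`; reaching it from `w` costs one more,
      -- hence 6 per tree step.
      new-linked : ∀ j b b′ → Near (suc (6 * suc (dist tree p j))) (end′ zero b) (end j b′)
      new-linked j b b′ = near-≤ (≤-reflexive (collect (dist tree p j)))
        (near-trans (from-new b) (linked p j b₀ b′))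
        where
        collect : ∀ a → 6 + suc (6 * a) ≡ suc (6 * suc a)
        collect = solve-∀
        from-new : ∀ b → Near 6 (end′ zero b) (end p b₀)
        from-new false = near-≤ (n≤1+n 5) (near-sym near-u)
        from-new true  = step (Adj-sym uw) (near-sym near-u)

      linked′ : ∀ i j b b′ → Near (suc (6 * dist (leaf tree p) i j)) (end′ i b) (end′ j b′)
      linked′ zero    zero    false false = stop
      linked′ zero    zero    false true  = step uw stop
      linked′ zero    zero    true  false = step (Adj-sym uw) stop
      linked′ zero    zero    true  true  = stop
      linked′ zero    (suc j) b     b′    = new-linked j b b′
      linked′ (suc i) zero    b     b′    = near-sym
        (subst (λ d → Near (suc (6 * suc d)) (end′ zero b′) (end i b)) (dist-sym tree p i) (new-linked i b′ b))
      linked′ (suc i) (suc j) b     b′    = linked i j b b′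

  single-edge : ∀ {u w} → Adj G u w → Skeleton 1
  single-edge {u} {w} uw = record
    { tree = single ; end = λ _ → end′ ; edge = λ _ → uw
    ; separated = λ { {zero} {zero} _ _ i≢j → contradiction refl i≢j }
    ; linked = λ _ _ → linked′ }
    where
    end′ : Bool → Fin n
    end′ false = u
    end′ true  = w
    linked′ : ∀ b b′ → Near 1 (end′ b) (end′ b′)
    linked′ false false = stop
    linked′ false true  = step uw stop
    linked′ true  false = step (Adj-sym uw) stop
    linked′ true  true  = stop

  -- `k + fuel` stays constant and exceeds `n`, while `k` is at most `n`, so the fuel cannot run out
  -- before all vertices are covered.
  grow : Connected G → ∀ fuel {k} → Skeleton k → n < k + fuel →
         ∃ λ k → Σ (Skeleton k) λ S → ∀ v → Covered S v
  grow conn zero       {k} S n<k = contradiction (skeleton-size S)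
    (<⇒≱ (subst (n <_) (+-identityʳ k) n<k))
  grow conn (suc fuel) {k} S n<k with all? (covered? S)
  ... | yes covered = k , S , covered
  ... | no ¬covered
    with v , ¬cv ← ¬∀⟶∃¬ n (Covered S) (covered? S) ¬covered
    -- A walk from a chosen edge to an uncovered vertex must leave the covered set, along an edge
    -- that `extend` can attach.
    with _ , walk ← conn (Skeleton.end S (root (Skeleton.tree S)) false) v
    with _ , _ , a , cx , ¬cy ← crossing (covered? S) walk (root (Skeleton.tree S) , false , stop) ¬cv =
    grow conn fuel (extend S a cx ¬cy) (subst (n <_) (+-suc k fuel) n<k)

-- Arithmetic of the estimate

⊓+⊔ : ∀ a b → a ⊓ b + (a ⊔ b) ≡ a + b
⊓+⊔ a b with ≤-total a b
... | inj₁ a≤b = cong₂ _+_ (m≤n⇒m⊓n≡m a≤b) (m≤n⇒m⊔n≡n a≤b)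
... | inj₂ b≤a = trans (cong₂ _+_ (m≥n⇒m⊓n≡n b≤a) (m≥n⇒m⊔n≡m b≤a)) (+-comm b a)

-- The quotient is taken of `m + k`, and the remainder modulo `suc k` is at most `k`.
ceilDiv-upper : ∀ m {k} → 1 ≤ k → m ≤ ceilDiv m k * k
ceilDiv-upper m {suc k} _ = +-cancelʳ-≤ k _ _ (begin
  m + k                                          ≡⟨ m≡m%n+[m/n]*n (m + k) (suc k) ⟩
  (m + k) % suc k + (m + k) / suc k * suc k      ≤⟨ +-monoˡ-≤ _ (≤-pred (m%n<n (m + k) (suc k))) ⟩
  k + (m + k) / suc k * suc k                    ≡⟨ +-comm k _ ⟩
  (m + k) / suc k * suc k + k                    ∎)
  where open ≤-Reasoning

-- With K = D + 1 + t, the claim reads n (D - 1 - 3t) ≤ 4sF. It is only of substance when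
-- D = 2 + 3t + r, and then (D + 1 + t) (D - 1 - 3t) ≤ D² - 1 ≤ 4F.
path-average : ∀ n s D K F → 1 ≤ s → n ≤ K * s → s * suc D ≤ n → D * D ≤ 1 + 4 * F →
               n * (4 * D + 2) ≤ 3 * (n * K) + 4 * (s * F)
path-average n s D K F 1≤s n≤Ks sD≤n D²≤ = cases n≤Ks (m≤n⇒∃[o]m+o≡n D<K)
  where
  open ≤-Reasoning
  -- Cancelling `s` in s(D + 1) ≤ n ≤ Ks gives the natural number t with K = D + 1 + t.
  D<K : suc D ≤ K
  D<K = *-cancelʳ-≤ (suc D) K s {{>-nonZero 1≤s}}
    (≤-trans (≤-reflexive (*-comm (suc D) s)) (≤-trans sD≤n n≤Ks))

  short : ∀ t → D < 2 + 3 * t → n * (4 * D + 2) ≤ 3 * (n * (suc D + t)) + 4 * (s * F)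
  short t D< = begin
    n * (4 * D + 2)                      ≡⟨ expand n D ⟩
    n * (3 * D + 2 + D)                  ≤⟨ *-monoʳ-≤ n (+-monoʳ-≤ (3 * D + 2) (≤-pred D<)) ⟩
    n * (3 * D + 2 + (1 + 3 * t))        ≡⟨ collect n D t ⟩
    3 * (n * (suc D + t))                ≤⟨ m≤m+n _ _ ⟩
    3 * (n * (suc D + t)) + 4 * (s * F)  ∎
    where
    expand : ∀ n D → n * (4 * D + 2) ≡ n * (3 * D + 2 + D)
    expand = solve-∀
    collect : ∀ n D t → n * (3 * D + 2 + (1 + 3 * t)) ≡ 3 * (n * (suc D + t))
    collect = solve-∀

  long : ∀ t r → 2 + 3 * t + r ≡ D → n ≤ (suc D + t) * s →
         n * (4 * D + 2) ≤ 3 * (n * (suc D + t)) + 4 * (s * F)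
  long t r refl n≤ = begin
    -- `suc r` is D - 1 - 3t, the excess of 4D + 2 over 3(D + 1 + t).
    n * (4 * D + 2)                                       ≡⟨ expand n t r ⟩
    3 * (n * (suc D + t)) + n * suc r                     ≤⟨ +-monoʳ-≤ _ (*-monoˡ-≤ (suc r) n≤) ⟩
    3 * (n * (suc D + t)) + (suc D + t) * s * suc r
      ≡⟨ cong (3 * (n * (suc D + t)) +_) (swap (suc D + t) s (suc r)) ⟩
    3 * (n * (suc D + t)) + s * ((suc D + t) * suc r)
      ≤⟨ +-monoʳ-≤ _ (*-monoʳ-≤ s (≤-pred (≤-trans (square t r) D²≤))) ⟩
    3 * (n * (suc D + t)) + s * (4 * F)                   ≡⟨ cong (3 * (n * (suc D + t)) +_) (pull s F) ⟩
    3 * (n * (suc D + t)) + 4 * (s * F)                   ∎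
    where
    expand : ∀ n t r → n * (4 * (2 + 3 * t + r) + 2) ≡
                       3 * (n * (suc (2 + 3 * t + r) + t)) + n * suc r
    expand = solve-∀
    swap : ∀ a s b → a * s * b ≡ s * (a * b)
    swap = solve-∀
    pull : ∀ s F → s * (4 * F) ≡ 4 * (s * F)
    pull = solve-∀
    square-expand : ∀ t r → (2 + 3 * t + r) * (2 + 3 * t + r) ≡
      suc ((suc (2 + 3 * t + r) + t) * suc r) + (9 * t * t + 8 * t + 2 * t * r)
    square-expand = solve-∀
    square : ∀ t r → suc ((suc (2 + 3 * t + r) + t) * suc r) ≤ (2 + 3 * t + r) * (2 + 3 * t + r)
    square t r = ≤-trans (m≤m+n _ _) (≤-reflexive (sym (square-expand t r)))

  cases : ∀ {K} → n ≤ K * s → ∃ (λ t → suc D + t ≡ K) →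
          n * (4 * D + 2) ≤ 3 * (n * K) + 4 * (s * F)
  cases n≤ (t , refl) with <-≤-connex D (2 + 3 * t)
  ... | inj₁ D< = short t D<
  ... | inj₂ D≥ = long t (D ∸ (2 + 3 * t)) (m+[n∸m]≡n D≥) n≤

-- Adding 2h to both sides avoids subtraction. As 2(6D + 11) = 3(4D + 2) + 16, three times
-- `path-average` yields the 9K and leaves the 16.
average-from-slack : ∀ n s D K F e h → 1 ≤ s → n ≤ K * s → s * suc D ≤ n → D * D ≤ 1 + 4 * F →
  e + h ≡ n * (6 * D + 11) → s * (6 * F) ≤ h → 2 * e ≤ n * (9 * K + 16)
average-from-slack n s D K F e h 1≤s n≤Ks sD≤n D²≤ total slack = +-cancelʳ-≤ (2 * h) _ _ (begin
  2 * e + 2 * h                             ≡⟨ *-distribˡ-+ 2 e h ⟨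
  2 * (e + h)                               ≡⟨ cong (2 *_) total ⟩
  2 * (n * (6 * D + 11))                    ≡⟨ expand n D ⟩
  3 * (n * (4 * D + 2)) + n * 16
    ≤⟨ +-monoˡ-≤ (n * 16) (*-monoʳ-≤ 3 (path-average n s D K F 1≤s n≤Ks sD≤n D²≤)) ⟩
  3 * (3 * (n * K) + 4 * (s * F)) + n * 16  ≡⟨ collect n K s F ⟩
  n * (9 * K + 16) + 2 * (s * (6 * F))      ≤⟨ +-monoʳ-≤ (n * (9 * K + 16)) (*-monoʳ-≤ 2 slack) ⟩
  n * (9 * K + 16) + 2 * h                  ∎)
  where
  open ≤-Reasoning
  expand : ∀ n D → 2 * (n * (6 * D + 11)) ≡ 3 * (n * (4 * D + 2)) + n * 16
  expand = solve-∀
  collect : ∀ n K s F → 3 * (3 * (n * K) + 4 * (s * F)) + n * 16 ≡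
                        n * (9 * K + 16) + 2 * (s * (6 * F))
  collect = solve-∀

-- Packed balls and the sum of eccentricities

module _ {n : ℕ} (G : Graph n) (girth : GirthAtLeast G 6) {d : ℕ} (deg : ∀ v → suc d ≤ degree G v)
         {k : ℕ} (S : Skeleton G k) (covered : ∀ v → Covered G S v) where
  open Skeleton S

  -- The balls at distinct edges are disjoint and have at least δ* vertices each. With weight 1 this
  -- counts vertices; with the slack as weight it bounds the total slack.
  packing : ∀ {m} (q : Fin m → Fin k) → (∀ {i j} → q i ≡ q j → i ≡ j) →
            (h : Fin n → ℕ) (c : Fin m → ℕ) → (∀ t {w} → w ∈ ball G S (q t) → c t ≤ h w) →
            deltaStar (suc d) * sumFin m c ≤ sumFin n h
  packing {m} q q-injective h c c≤h = ≤-trans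
    (sum-concat-tabulate h (deltaStar (suc d)) m c (ball G S ∘ q)
      (λ t → length-edgeBall G deg (end (q t) false) (end (q t) true)) c≤h)
    (sum-unique≤sumFin h (Uniqueₚ.concat⁺
      (Allₚ.tabulate⁺ (λ t → edgeBall-unique G girth (edge (q t))))
      (AllPairsₚ.tabulate⁺ (λ i≢j → ball-disjoint G S (i≢j ∘ q-injective)))))

  -- A farthest vertex from `v` is itself near some edge `j`, and `near-edges` bounds the distance
  -- through the tree.
  ecc-bound : ∀ {v e i m} → IsEcc G v e → NearEdge G S i v → (∀ j → dist tree i j ≤ m) →
              e ≤ 6 * m + 11
  ecc-bound {i = i} (_ , w , isDist) near max with j , near′ ← covered w = ≤-trans
    (dist≤near G isDist (near-edges G S near near′)) (+-monoˡ-≤ 11 (*-monoʳ-≤ 6 (max j)))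

  ecc-bound-in-ball : ∀ {v e i m} → IsEcc G v e → v ∈ ball G S i → (∀ j → dist tree i j ≤ m) →
                      e ≤ 6 * m + 11
  ecc-bound-in-ball {i = i} isEcc v∈ = ecc-bound isEcc
    (let b , near = ball⇒near G S {i} v∈ in b , near-≤ G (m≤m+n 2 3) near)

  sum-ecc-bound : ∀ {ecc} → (∀ v → IsEcc G v (ecc v)) →
                  ∀ x y → (∀ i j → dist tree i j ≤ dist tree x y) →
                  2 * sumFin n ecc ≤ n * (9 * ceilDiv n (deltaStar (suc d)) + 16)
  sum-ecc-bound {ecc} isEcc x y max =
    average-from-slack n s D (ceilDiv n s) (endDistanceSum D) (sumFin n ecc) (sumFin n slack)
      1≤s (ceilDiv-upper n 1≤s) s*[1+D]≤n (D²≤1+4*endDistanceSum D)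
      (sumFin-complement n (6 * D + 11) ecc ecc≤) slack-bound
    where
    open ≤-Reasoning
    s = deltaStar (suc d)
    D = dist tree x y

    1≤s : 1 ≤ s
    1≤s = ≤-trans (s≤s z≤n) (m≤n+m 2 (2 * suc d * suc d ∸ 2 * suc d))

    slack : Fin n → ℕ
    slack v = 6 * D + 11 ∸ ecc v

    ecc≤ : ∀ v → ecc v ≤ 6 * D + 11
    ecc≤ v = let i , near = covered v in ecc-bound (isEcc v) near (max i)

    t≤D : (t : Fin (suc D)) → toℕ t ≤ D
    t≤D t = ≤-pred (toℕ<n t)

    on-path : ∀ (t : Fin (suc D)) → ∃ λ q → dist tree x q ≡ toℕ t × dist tree q y ≡ D ∸ toℕ t
    on-path t = dist-between tree x y (toℕ t) (D ∸ toℕ t) (m+[n∸m]≡n (t≤D t))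

    path : Fin (suc D) → Fin k
    path t = proj₁ (on-path t)

    -- The distance from `x` recovers the position on the path.
    path-injective : ∀ {i j} → path i ≡ path j → i ≡ j
    path-injective {i} {j} eq = toℕ-injective (trans (sym (proj₁ (proj₂ (on-path i))))
      (trans (cong (dist tree x) eq) (proj₁ (proj₂ (on-path j)))))

    s*[1+D]≤n : s * suc D ≤ n
    s*[1+D]≤n = begin
      s * suc D                     ≡⟨ cong (s *_) (*-identityʳ (suc D)) ⟨
      s * (suc D * 1)               ≡⟨ cong (s *_) (sumFin-const (suc D) 1) ⟨
      s * sumFin (suc D) (λ _ → 1)  ≤⟨ packing path path-injective (λ _ → 1) (λ _ → 1) (λ _ _ → ≤-refl) ⟩
      sumFin n (λ _ → 1)            ≡⟨ sumFin-const n 1 ⟩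
      n * 1                         ≡⟨ *-identityʳ n ⟩
      n                             ∎

    -- At position t the tree eccentricity is at most max(t, D - t), which falls short of D by
    -- min(t, D - t).
    slack-on-path : ∀ t {w} → w ∈ ball G S (path t) → 6 * (toℕ t ⊓ (D ∸ toℕ t)) ≤ slack w
    slack-on-path t {w} w∈ = m+n≤o⇒m≤o∸n (6 * a) (begin
      6 * a + ecc w            ≤⟨ +-monoʳ-≤ (6 * a) (ecc-bound-in-ball {i = path t} (isEcc w) w∈ on-path-max) ⟩
      6 * a + (6 * c + 11)     ≡⟨ regroup a c ⟩
      6 * (a + c) + 11         ≡⟨ cong (λ z → 6 * z + 11) (trans (⊓+⊔ (toℕ t) (D ∸ toℕ t)) (m+[n∸m]≡n (t≤D t))) ⟩
      6 * D + 11               ∎)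
      where
      a = toℕ t ⊓ (D ∸ toℕ t)
      c = toℕ t ⊔ (D ∸ toℕ t)
      regroup : ∀ a c → 6 * a + (6 * c + 11) ≡ 6 * (a + c) + 11
      regroup = solve-∀
      on-path-max : ∀ j → dist tree (path t) j ≤ c
      on-path-max j = ≤-trans (dist-from-diametral tree x y max (path t) j)
        (≤-reflexive (cong₂ _⊔_ (proj₁ (proj₂ (on-path t))) (proj₂ (proj₂ (on-path t)))))

    slack-bound : s * (6 * endDistanceSum D) ≤ sumFin n slack
    slack-bound = ≤-trans
      (≤-reflexive (cong (s *_) (sym (sumFin-*ˡ (suc D) 6 (λ t → toℕ t ⊓ (D ∸ toℕ t))))))
      (packing path path-injective slack (λ t → 6 * (toℕ t ⊓ (D ∸ toℕ t))) slack-on-path)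

nonempty : {A : Set} (xs : List A) → 1 ≤ length xs → ∃ (_∈ xs)
nonempty (x ∷ _) _ = x , here refl

theorem2 : ∀ (n : ℕ) (G : Graph n) (δ : ℕ) (ecc : Fin n → ℕ) →
    Connected G → IsMinDegree G δ → 3 ≤ δ → GirthAtLeast G 6 →
    (∀ v → IsEcc G v (ecc v)) →
    2 * sumFin n ecc ≤ n * (9 * ceilDiv n (deltaStar δ) + 16)
theorem2 n G (suc d) ecc conn (deg , v , _) _ girth isEcc
  -- Positive minimum degree gives `v` a neighbour, hence a first edge.
  with w , w∈ ← nonempty (neighbours G v) (≤-trans (s≤s z≤n) (deg v))
  -- Starting from one edge, fuel `n` suffices because n < 1 + n.
  with k , S , covered ← grow G conn n (single-edge G (neighbours⇒Adj G w∈)) ≤-refl =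
  let x , y , max = diameter (Skeleton.tree S) in sum-ecc-bound G girth deg S covered isEcc x y max
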